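{- For $m,n\ge2$, \[ \sum_{k=2}^m\sum_{l=2}^n k!\left\{{m\atop k}\right\}\, l!\left\{{n\atop l}\right\}\,G_{k,l}=1-\frac{m!\,n!}{(m+n-1)!}. \]
   Context: The generalized Gregory coefficients $G_{m,n}$ are defined by $\sum_{m,n\ge0}G_{m,n}x^my^n=\dfrac{y\log^2(1+x)-x\log^2(1+y)}{\log(1+x)-\log(1+y)}$ (formal power series; $\log^ku=(\log u)^k$). $\left\{{n\atop m}\right\}$ are the Stirling numbers of the second kind: $\left\{{n+1\atop m}\right\}=\left\{{n\atop m-1}\right\}+m\left\{{n\atop m}\right\}$, $\left\{{0\atop 0}\right\}=1$, $\left\{{n\atop 0}\right\}=\left\{{0\atop m}\right\}=0$ for $n,m\ne0$. -}

module Defs where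

import Algebra.Properties.CommutativeMonoid.Sum
open import Data.Fin.Base using (toℕ)
open import Data.Integer.Base as ℤ using (+_; -1ℤ)
open import Data.Nat.Base as ℕ using (ℕ; zero; suc; _∸_; _!)
open import Data.Nat.Properties using (_!≢0)
open import Data.Rational.Base using (ℚ; 0ℚ; 1ℚ; _+_; _*_; _-_; _/_)
open import Data.Rational.Properties using (+-0-commutativeMonoid)
open import Relation.Binary.PropositionalEquality.Core using (_≡_)

open Algebra.Properties.CommutativeMonoid.Sum +-0-commutativeMonoid
  using (sum⁺-syntax; sum-syntax)

fromℕ : ℕ → ℚ
fromℕ n = + n / 1

_/!_ : ℕ → ℕ → ℚ
a /! n = (+ a / n !) {{n !≢0}}

-- Both endpoints are included; the sum is 0 when b < a.
sumFromTo : ℕ → ℕ → (ℕ → ℚ) → ℚ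
sumFromTo a b f = ∑[ i < suc b ∸ a ] f (a ℕ.+ toℕ i)

syntax sumFromTo a b (λ k → e) = Σ[ k from a to b ] e

stirling₂ : ℕ → ℕ → ℕ
stirling₂ zero    zero    = 1
stirling₂ zero    (suc m) = 0
stirling₂ (suc n) zero    = 0
stirling₂ (suc n) (suc m) = stirling₂ n m ℕ.+ suc m ℕ.* stirling₂ n (suc m)

-- ℚ[[t]] and ℚ[[x,y]] by coefficients: F m n is the coefficient of xᵐyⁿ.
Series₁ Series₂ : Set
Series₁ = ℕ → ℚ
Series₂ = ℕ → ℕ → ℚ

infix  4 _≈_
infixl 6 _⊖_
infixl 7 _⊛_

_≈_ : Series₂ → Series₂ → Set
F ≈ H = ∀ m n → F m n ≡ H m n

_⊖_ : Series₂ → Series₂ → Series₂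
(F ⊖ H) m n = F m n - H m n

_⊛_ : Series₂ → Series₂ → Series₂
(F ⊛ H) m n = ∑[ i ≤ m ] ∑[ j ≤ n ] (F (toℕ i) (toℕ j) * H (m ∸ toℕ i) (n ∸ toℕ j))

-- f(t) ↦ f(x) and f(t) ↦ f(y).
inX inY : Series₁ → Series₂
inX f m zero    = f m
inX f m (suc n) = 0ℚ
inY f m n = inX f n m

var : Series₁
var 1 = 1ℚ
var _ = 0ℚ

-- log(1+t) = Σ_{k≥1} (-1)ᵏ⁻¹ tᵏ / k
log1+ : Series₁
log1+ zero    = 0ℚ
log1+ (suc k) = (-1ℤ ℤ.^ k) / suc k

x y log[1+x] log[1+y] : Series₂
x        = inX var
y        = inY var
log[1+x] = inX log1+
log[1+y] = inY log1+

gregoryNumerator gregoryDenominator : Series₂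
gregoryNumerator   = y ⊛ (log[1+x] ⊛ log[1+x]) ⊖ x ⊛ (log[1+y] ⊛ log[1+y])
gregoryDenominator = log[1+x] ⊖ log[1+y]

-- G is the quotient numerator / denominator in ℚ[[x,y]].  The denominator has
-- zero constant term, so it is not a unit and the quotient is expressed by
-- multiplying out.  As ℚ[[x,y]] is an integral domain there is at most one
-- such G.  It exists because, with a = log(1+x) and b = log(1+y), the
-- numerator is y(a + b)(a - b) - b²(x - y), and a - b is (x - y) times a
-- series with constant term 1.
IsGeneralizedGregory : Series₂ → Set
IsGeneralizedGregory G = G ⊛ gregoryDenominator ≈ gregoryNumerator

{-# OPTIONS --safe #-}
-- Put P(u,v) = G(eᵘ - 1, eᵛ - 1).  As k! S(m,k) is m! times the coefficient of uᵐ in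
-- (eᵘ - 1)ᵏ, the sum over all k and l is m! n! times the coefficient of uᵐvⁿ in P.
-- The definition of G becomes (u - v) P = (eᵛ - 1) u² - (eᵘ - 1) v², which is solved
-- for the coefficients of P: for m, n ≥ 2 they are -1/(m + n - 1)!, while the terms
-- with k = 1 or l = 1, which the sum omits, account for the summand 1.

module Submission where

open import Defs
open import Data.Nat.Base as ℕ using (ℕ; zero; suc; pred; _≤_; _∸_; _!; s≤s; z≤n)
open import Data.Rational.Base using (ℚ; 0ℚ; 1ℚ; _+_; _*_; _-_; -_; _/_; 1/_; toℚᵘ)
open import Relation.Binary.PropositionalEquality.Core using (_≡_; refl; sym; trans; cong; cong₂)
open import Relation.Binary.PropositionalEquality.Properties using (module ≡-Reasoning)

import Algebra.Properties.Semiring.Sum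
open import Algebra.Bundles using (CommutativeRing)
open import Data.Fin.Base using (Fin; toℕ)
open import Data.Fin.Properties using (toℕ-inject₁; toℕ-fromℕ; toℕ≤pred[n])
open import Data.Integer.Base as ℤ using (+_; -1ℤ)
import Data.Integer.Properties as ℤ
import Data.Integer.Solver as ℤ
import Data.Nat.Properties as ℕ
import Data.Nat.Solver as ℕ
open import Data.Rational.Properties
open import Data.Rational.Solver using (module +-*-Solver)
import Data.Rational.Unnormalised.Base as ℚᵘ
import Data.Rational.Unnormalised.Properties as ℚᵘ

open ≡-Reasoning
open +-*-Solver using (solve; _:=_; _:+_; _:*_; _:-_; :-_; con)
open Algebra.Properties.Semiring.Sum (CommutativeRing.semiring +-*-commutativeRing)

private
  variable
    f g : Series₁

-- Integers and fractions in ℚ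

toℚᵘ-/1 : ∀ i → toℚᵘ (i / 1) ℚᵘ.≃ ℚᵘ.mkℚᵘ i 0
toℚᵘ-/1 i = toℚᵘ-fromℚᵘ (ℚᵘ.mkℚᵘ i 0)

/1-homo-+ : ∀ i j → (i ℤ.+ j) / 1 ≡ i / 1 + j / 1
/1-homo-+ i j = toℚᵘ-injective (ℚᵘ.≃-trans (toℚᵘ-/1 (i ℤ.+ j)) (ℚᵘ.≃-trans
  (ℚᵘ.*≡* (ℤ.+-*-Solver.solve 2 (λ i j → (i :+ᶻ j) :*ᶻ conᶻ ℤ.1ℤ :=ᶻ
    (i :*ᶻ conᶻ ℤ.1ℤ :+ᶻ j :*ᶻ conᶻ ℤ.1ℤ) :*ᶻ conᶻ ℤ.1ℤ) refl i j))
  (ℚᵘ.≃-sym (ℚᵘ.≃-trans (toℚᵘ-homo-+ (i / 1) (j / 1)) (ℚᵘ.+-cong (toℚᵘ-/1 i) (toℚᵘ-/1 j))))))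
  where open ℤ.+-*-Solver renaming (_:+_ to _:+ᶻ_; _:*_ to _:*ᶻ_; _:=_ to _:=ᶻ_; con to conᶻ)

/1-homo-* : ∀ i j → (i ℤ.* j) / 1 ≡ (i / 1) * (j / 1)
/1-homo-* i j = toℚᵘ-injective (ℚᵘ.≃-trans (toℚᵘ-/1 (i ℤ.* j))
  (ℚᵘ.≃-sym (ℚᵘ.≃-trans (toℚᵘ-homo-* (i / 1) (j / 1)) (ℚᵘ.*-cong (toℚᵘ-/1 i) (toℚᵘ-/1 j)))))

fromℕ-homo-+ : ∀ m n → fromℕ (m ℕ.+ n) ≡ fromℕ m + fromℕ n
fromℕ-homo-+ m n = /1-homo-+ (+ m) (+ n)

fromℕ-homo-* : ∀ m n → fromℕ (m ℕ.* n) ≡ fromℕ m * fromℕ n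
fromℕ-homo-* m n = trans (cong (_/ 1) (ℤ.pos-* m n)) (/1-homo-* (+ m) (+ n))

fromℕ-*-/ : ∀ i d .{{_ : ℕ.NonZero d}} → fromℕ d * (i / d) ≡ i / 1
fromℕ-*-/ i d@(suc d-1) = toℚᵘ-injective (ℚᵘ.≃-trans (toℚᵘ-homo-* (fromℕ d) (i / d))
  (ℚᵘ.≃-trans (ℚᵘ.*-cong (toℚᵘ-/1 (+ d)) (toℚᵘ-fromℚᵘ (ℚᵘ.mkℚᵘ i d-1)))
  (ℚᵘ.≃-trans (ℚᵘ.*≡* (trans (ℤ.*-identityʳ (+ d ℤ.* i)) (trans (ℤ.*-comm (+ d) i)
    (cong (λ e → i ℤ.* + suc e) (sym (ℕ.+-identityʳ d-1))))))
  (ℚᵘ.≃-sym (toℚᵘ-/1 i)))))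

fromℕ-*-cancelˡ : ∀ d .{{_ : ℕ.NonZero d}} {p q} → fromℕ d * p ≡ fromℕ d * q → p ≡ q
fromℕ-*-cancelˡ d {p} {q} eq = begin
  p                       ≡⟨ undo p ⟨
  1/ c * (c * p)          ≡⟨ cong (1/ c *_) eq ⟩
  1/ c * (c * q)          ≡⟨ undo q ⟩
  q                       ∎
  where
  c = fromℕ d
  instance _ = pos⇒nonZero c {{normalize-pos d 1}}
  undo : ∀ r → 1/ c * (c * r) ≡ r
  undo r = trans (sym (*-assoc (1/ c) c r)) (trans (cong (_* r) (*-inverseˡ c)) (*-identityˡ r))

-- Finite sums

∑-zero : ∀ n {t : Fin n → ℚ} → (∀ i → t i ≡ 0ℚ) → sum t ≡ 0ℚ
∑-zero n t≡0 = trans (sum-cong-≗ t≡0) (sum-replicate-zero n)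

∑-distrib-∸ : ∀ n (s t : Fin n → ℚ) → ∑[ i < n ] (s i - t i) ≡ ∑[ i < n ] s i - ∑[ i < n ] t i
∑-distrib-∸ n s t = begin
  ∑[ i < n ] (s i - t i)                        ≡⟨ ∑-distrib-+ s (λ i → - t i) ⟩
  ∑[ i < n ] s i + ∑[ i < n ] (- t i)           ≡⟨ cong (_+_ (sum s)) (sum-cong-≗ (λ i → neg (t i))) ⟩
  ∑[ i < n ] s i + ∑[ i < n ] (- 1ℚ * t i)      ≡⟨ cong (_+_ (sum s)) (*-distribˡ-sum (- 1ℚ) t) ⟨
  ∑[ i < n ] s i + - 1ℚ * ∑[ i < n ] t i        ≡⟨ cong (_+_ (sum s)) (neg (sum t)) ⟨
  ∑[ i < n ] s i - ∑[ i < n ] t i               ∎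
  where
  neg : ∀ p → - p ≡ - 1ℚ * p
  neg = solve 1 (λ p → :- p := con (- 1ℚ) :* p) refl

∑-≤-suc : ∀ n (f : Series₁) → ∑[ i ≤ suc n ] f (toℕ i) ≡ ∑[ i ≤ n ] f (toℕ i) + f (suc n)
∑-≤-suc n f = trans (sum-init-last {suc n} (λ i → f (toℕ i)))
  (cong₂ _+_ (sum-cong-≗ {suc n} (λ i → cong f (toℕ-inject₁ i))) (cong f (toℕ-fromℕ (suc n))))

-- Only i = n survives, since for every smaller i the second argument is a successor. The two-index
-- form covers both a convolution with a constant series and the outer sum of `⊛` with a series in y
-- alone.
∑-last : ∀ (c : ℕ → ℕ → ℚ) → (∀ i j → c i (suc j) ≡ 0ℚ) →
  ∀ n → ∑[ i ≤ n ] c (toℕ i) (n ∸ toℕ i) ≡ c n 0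
∑-last c c≡0 zero    = +-identityʳ (c 0 0)
∑-last c c≡0 (suc n) = trans (cong₂ _+_ (c≡0 0 n) (∑-last (λ i → c (suc i)) (λ i → c≡0 (suc i)) n))
  (+-identityˡ (c (suc n) 0))

-- Products of power series

infixl 7 _⋆_

_⋆_ : Series₁ → Series₁ → Series₁
(f ⋆ g) n = ∑[ i ≤ n ] (f (toℕ i) * g (n ∸ toℕ i))

⋆-distribʳ-+ : ∀ f g h n → ((λ k → f k + g k) ⋆ h) n ≡ (f ⋆ h) n + (g ⋆ h) n
⋆-distribʳ-+ f g h n = trans
  (sum-cong-≗ {suc n} (λ i → *-distribʳ-+ (h (n ∸ toℕ i)) (f (toℕ i)) (g (toℕ i))))
  (∑-distrib-+ {suc n} (λ i → f (toℕ i) * h (n ∸ toℕ i)) (λ i → g (toℕ i) * h (n ∸ toℕ i)))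

⋆-constantˡ : (∀ k → f (suc k) ≡ 0ℚ) → ∀ n → (f ⋆ g) n ≡ f 0 * g n
⋆-constantˡ {f} {g} f≡0 zero    = +-identityʳ _
⋆-constantˡ {f} {g} f≡0 (suc n) = trans
  (cong (_+_ (f 0 * g (suc n))) (∑-zero (suc n) (λ i → trans (cong (_* g (n ∸ toℕ i)) (f≡0 (toℕ i))) (*-zeroˡ (g (n ∸ toℕ i))))))
  (+-identityʳ _)

⋆-constantʳ : (∀ k → g (suc k) ≡ 0ℚ) → ∀ n → (f ⋆ g) n ≡ f n * g 0
⋆-constantʳ {g} {f} g≡0 = ∑-last (λ i j → f i * g j) (λ i j → trans (cong (f i *_) (g≡0 j)) (*-zeroʳ (f i)))

-- For each i the inner sum is a convolution with a series constant in y and collapses to one term.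
-- The hypothesis is `≈` because the squared logarithms agree with `inX log²` and `inY log²` only
-- coefficient by coefficient.
⊛-inX : ∀ G {F} → F ≈ inX f → ∀ m n → (G ⊛ F) m n ≡ ((λ i → G i n) ⋆ f) m
⊛-inX {f} G {F} F≈f m n = sum-cong-≗ {suc m} λ i → trans
  (⋆-constantʳ {F (m ∸ toℕ i)} {G (toℕ i)} (λ j → F≈f (m ∸ toℕ i) (suc j)) n)
  (cong (G (toℕ i) n *_) (F≈f (m ∸ toℕ i) 0))

⊛-inY : ∀ G {F} → F ≈ inY f → ∀ m n → (G ⊛ F) m n ≡ (G m ⋆ f) n
⊛-inY {f} G {F} F≈f m n = trans
  (∑-last (λ i a → (G i ⋆ F a) n) (λ i a → ∑-zero (suc n) (λ j →
    trans (cong (G i (toℕ j) *_) (F≈f (suc a) (n ∸ toℕ j))) (*-zeroʳ (G i (toℕ j))))) m)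
  (sum-cong-≗ {suc n} (λ j → cong (G m (toℕ j) *_) (F≈f 0 (n ∸ toℕ j))))

⊛-distribˡ-⊖ : ∀ G F H → G ⊛ (F ⊖ H) ≈ G ⊛ F ⊖ G ⊛ H
⊛-distribˡ-⊖ G F H m n = trans
  (sum-cong-≗ {suc m} (λ i → trans
    (sum-cong-≗ {suc n} (λ j → solve 3 (λ a b c → a :* (b :- c) := a :* b :- a :* c) refl
      (G (toℕ i) (toℕ j)) (F (m ∸ toℕ i) (n ∸ toℕ j)) (H (m ∸ toℕ i) (n ∸ toℕ j))))
    (∑-distrib-∸ (suc n) (F-terms i) (H-terms i))))
  (∑-distrib-∸ (suc m) (λ i → ∑[ j ≤ n ] F-terms i j) (λ i → ∑[ j ≤ n ] H-terms i j))
  where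
  F-terms H-terms : Fin (suc m) → Fin (suc n) → ℚ
  F-terms i j = G (toℕ i) (toℕ j) * F (m ∸ toℕ i) (n ∸ toℕ j)
  H-terms i j = G (toℕ i) (toℕ j) * H (m ∸ toℕ i) (n ∸ toℕ j)

-- The derivation (1 + t) d/dt

-- `t∂` is t d/dt, so k ↦ `t∂ f (suc k)` lists the coefficients of f′, and `θ f` is f′ + t f′.
t∂ θ : Series₁ → Series₁
t∂ f k = fromℕ k * f k
θ f k = t∂ f (suc k) + t∂ f k

-- Leibniz rule: the factor n is split as i + (n - i) inside each term.
t∂-⋆ : ∀ f g n → t∂ (f ⋆ g) n ≡ (t∂ f ⋆ g) n + (f ⋆ t∂ g) n
t∂-⋆ f g n = begin
  fromℕ n * (f ⋆ g) n
    ≡⟨ *-distribˡ-sum {suc n} (fromℕ n) (λ i → f (toℕ i) * g (n ∸ toℕ i)) ⟩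
  ∑[ i ≤ n ] (fromℕ n * (f (toℕ i) * g (n ∸ toℕ i)))
    ≡⟨ sum-cong-≗ {suc n} (λ i → cong (_* (f (toℕ i) * g (n ∸ toℕ i))) (split i)) ⟩
  ∑[ i ≤ n ] ((fromℕ (toℕ i) + fromℕ (n ∸ toℕ i)) * (f (toℕ i) * g (n ∸ toℕ i)))
    ≡⟨ sum-cong-≗ {suc n} (λ i → solve 4 (λ a b c d → (a :+ b) :* (c :* d) := (a :* c) :* d :+ c :* (b :* d)) refl
         (fromℕ (toℕ i)) (fromℕ (n ∸ toℕ i)) (f (toℕ i)) (g (n ∸ toℕ i))) ⟩
  ∑[ i ≤ n ] (t∂ f (toℕ i) * g (n ∸ toℕ i) + f (toℕ i) * t∂ g (n ∸ toℕ i))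
    ≡⟨ ∑-distrib-+ {suc n} (λ i → t∂ f (toℕ i) * g (n ∸ toℕ i)) (λ i → f (toℕ i) * t∂ g (n ∸ toℕ i)) ⟩
  (t∂ f ⋆ g) n + (f ⋆ t∂ g) n ∎
  where
  split : ∀ (i : Fin (suc n)) → fromℕ n ≡ fromℕ (toℕ i) + fromℕ (n ∸ toℕ i)
  split i = trans (cong fromℕ (sym (ℕ.m+[n∸m]≡n (toℕ≤pred[n] i)))) (fromℕ-homo-+ (toℕ i) (n ∸ toℕ i))

-- The hypotheses say (1 + t) g = t.
⋆-t/1+t : g 0 ≡ 0ℚ → g 1 ≡ 1ℚ → (∀ k → g (suc (suc k)) + g (suc k) ≡ 0ℚ) →
  ∀ f n → (f ⋆ g) (suc n) + (f ⋆ g) n ≡ f n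
⋆-t/1+t {g} g₀ g₁ g₂ f zero rewrite g₀ | g₁ = solve 2
  (λ a b → (a :* con 1ℚ :+ (b :* con 0ℚ :+ con 0ℚ)) :+ (a :* con 0ℚ :+ con 0ℚ) := a) refl (f 0) (f 1)
⋆-t/1+t {g} g₀ g₁ g₂ f (suc n) = begin
  (f 0 * g (suc (suc n)) + (f′ ⋆ g) (suc n)) + (f 0 * g (suc n) + (f′ ⋆ g) n)
    -- Splitting off i = 0 leaves convolutions of the shifted series `f′` one degree lower, so the
    -- induction on n has to range over all f.
    ≡⟨ solve 5 (λ a b c d e → (a :* b :+ c) :+ (a :* d :+ e) := a :* (b :+ d) :+ (c :+ e)) refl
         (f 0) (g (suc (suc n))) ((f′ ⋆ g) (suc n)) (g (suc n)) ((f′ ⋆ g) n) ⟩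
  f 0 * (g (suc (suc n)) + g (suc n)) + ((f′ ⋆ g) (suc n) + (f′ ⋆ g) n)
    ≡⟨ cong₂ _+_ (trans (cong (f 0 *_) (g₂ n)) (*-zeroʳ (f 0))) (⋆-t/1+t {g} g₀ g₁ g₂ f′ n) ⟩
  0ℚ + f′ n
    ≡⟨ +-identityˡ (f′ n) ⟩
  f′ n ∎
  where
  f′ : Series₁
  f′ k = f (suc k)

t∂-log1+ : ∀ k → t∂ log1+ (suc k) ≡ (-1ℤ ℤ.^ k) / 1
t∂-log1+ k = fromℕ-*-/ (-1ℤ ℤ.^ k) (suc k)

-- `t∂ log1+` is t/(1 + t); multiplied by 1 + t it leaves t, whose coefficients vanish from degree 2
-- on.
t∂-log1+-alternates : ∀ k → t∂ log1+ (suc (suc k)) + t∂ log1+ (suc k) ≡ 0ℚ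
t∂-log1+-alternates k = begin
  t∂ log1+ (suc (suc k)) + t∂ log1+ (suc k)  ≡⟨ cong₂ _+_ (t∂-log1+ (suc k)) (t∂-log1+ k) ⟩
  (-1ℤ ℤ.* e) / 1 + e / 1                    ≡⟨ /1-homo-+ (-1ℤ ℤ.* e) e ⟨
  (-1ℤ ℤ.* e ℤ.+ e) / 1                      ≡⟨ cong (λ i → (i ℤ.+ e) / 1) (ℤ.-1*i≡-i e) ⟩
  (ℤ.- e ℤ.+ e) / 1                          ≡⟨ cong (_/ 1) (ℤ.+-inverseˡ e) ⟩
  0ℚ                                         ∎
  where e = -1ℤ ℤ.^ k

-- `θ` is a derivation, and (1 + t) d/dt log(1 + t) = 1.
θ-⋆-log1+ : ∀ f n → θ (f ⋆ log1+) n ≡ (θ f ⋆ log1+) n + f n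
θ-⋆-log1+ f n = begin
  t∂ (f ⋆ log1+) (suc n) + t∂ (f ⋆ log1+) n
    ≡⟨ cong₂ _+_ (t∂-⋆ f log1+ (suc n)) (t∂-⋆ f log1+ n) ⟩
  ((0ℚ * f 0) * log1+ (suc n) + ((λ k → t∂ f (suc k)) ⋆ log1+) n + (f ⋆ t∂ log1+) (suc n))
    + ((t∂ f ⋆ log1+) n + (f ⋆ t∂ log1+) n)
    -- At `suc n` the term i = 0 of `t∂ f ⋆ log1+` carries the factor 0; the other terms form the
    -- convolution of f′ with `log1+` at n.
    ≡⟨ solve 6 (λ a b c d e p → (con 0ℚ :* a) :* b :+ c :+ d :+ (e :+ p) := (c :+ e) :+ (d :+ p)) refl
         (f 0) (log1+ (suc n)) (((λ k → t∂ f (suc k)) ⋆ log1+) n) ((f ⋆ t∂ log1+) (suc n))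
         ((t∂ f ⋆ log1+) n) ((f ⋆ t∂ log1+) n) ⟩
  (((λ k → t∂ f (suc k)) ⋆ log1+) n + (t∂ f ⋆ log1+) n) + ((f ⋆ t∂ log1+) (suc n) + (f ⋆ t∂ log1+) n)
    ≡⟨ cong₂ _+_ (sym (⋆-distribʳ-+ (λ k → t∂ f (suc k)) (t∂ f) log1+ n))
         (⋆-t/1+t {t∂ log1+} refl refl t∂-log1+-alternates f n) ⟩
  (θ f ⋆ log1+) n + f n ∎

-- Substituting eᵘ - 1

weight : ℕ → ℕ → ℚ
weight m k = fromℕ (k ! ℕ.* stirling₂ m k)

-- egf f m is m! times the coefficient of uᵐ in f(eᵘ - 1), because
-- (eᵘ - 1)ᵏ = Σₘ k! S(m,k) uᵐ/m!.
egf : Series₁ → Series₁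
egf f m = ∑[ k ≤ m ] (weight m (toℕ k) * f (toℕ k))

-- The offset `d` is arbitrary because the recurrence for row m + 1 calls on the offsets d and d + 1
-- in row m.
stirling₂-above : ∀ m d → stirling₂ m (suc (d ℕ.+ m)) ≡ 0
stirling₂-above zero    d = refl
stirling₂-above (suc m) d rewrite ℕ.+-suc d m | stirling₂-above m d | stirling₂-above m (suc d)
  = ℕ.*-zeroʳ (d ℕ.+ m)

stirling₂-1 : ∀ m → stirling₂ (suc m) 1 ≡ 1
stirling₂-1 zero    = refl
stirling₂-1 (suc m) = trans (ℕ.+-identityʳ _) (stirling₂-1 m)

weight-above : ∀ m → weight m (suc m) ≡ 0ℚ
weight-above m = cong fromℕ (trans (cong (suc m ! ℕ.*_) (stirling₂-above m 0)) (ℕ.*-zeroʳ (suc m !)))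

weight-1 : ∀ m → weight (suc m) 1 ≡ 1ℚ
weight-1 m = cong fromℕ (trans (ℕ.*-identityˡ _) (stirling₂-1 m))

-- Coefficient form of d/du (eᵘ - 1)ᵏ⁺¹ = (k + 1)((eᵘ - 1)ᵏ + (eᵘ - 1)ᵏ⁺¹).
weight-suc : ∀ m k → weight (suc m) (suc k) ≡ weight m k * fromℕ (suc k) + weight m (suc k) * fromℕ (suc k)
weight-suc m k = begin
  fromℕ (suc k ! ℕ.* (s ℕ.+ suc k ℕ.* s′))
    ≡⟨ cong fromℕ (ℕ.+-*-Solver.solve 4 (λ c k! s s′ → c :*ⁿ k! :*ⁿ (s :+ⁿ c :*ⁿ s′) :=ⁿ
         k! :*ⁿ s :*ⁿ c :+ⁿ c :*ⁿ k! :*ⁿ s′ :*ⁿ c) refl (suc k) (k !) s s′) ⟩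
  fromℕ (k ! ℕ.* s ℕ.* suc k ℕ.+ suc k ! ℕ.* s′ ℕ.* suc k)
    ≡⟨ fromℕ-homo-+ (k ! ℕ.* s ℕ.* suc k) (suc k ! ℕ.* s′ ℕ.* suc k) ⟩
  fromℕ (k ! ℕ.* s ℕ.* suc k) + fromℕ (suc k ! ℕ.* s′ ℕ.* suc k)
    ≡⟨ cong₂ _+_ (fromℕ-homo-* (k ! ℕ.* s) (suc k)) (fromℕ-homo-* (suc k ! ℕ.* s′) (suc k)) ⟩
  weight m k * fromℕ (suc k) + weight m (suc k) * fromℕ (suc k) ∎
  where
  s s′ : ℕ
  s  = stirling₂ m k
  s′ = stirling₂ m (suc k)
  open ℕ.+-*-Solver renaming (_:+_ to _:+ⁿ_; _:*_ to _:*ⁿ_; _:=_ to _:=ⁿ_)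

egf-cong : (∀ k → f k ≡ g k) → ∀ m → egf f m ≡ egf g m
egf-cong f≡g m = sum-cong-≗ {suc m} (λ k → cong (weight m (toℕ k) *_) (f≡g (toℕ k)))

egf-+ : ∀ f g m → egf (λ k → f k + g k) m ≡ egf f m + egf g m
egf-+ f g m = trans
  (sum-cong-≗ {suc m} (λ k → *-distribˡ-+ (weight m (toℕ k)) (f (toℕ k)) (g (toℕ k))))
  (∑-distrib-+ {suc m} (λ k → weight m (toℕ k) * f (toℕ k)) (λ k → weight m (toℕ k) * g (toℕ k)))

egf-∸ : ∀ f g m → egf (λ k → f k - g k) m ≡ egf f m - egf g m
egf-∸ f g m = trans
  (sum-cong-≗ {suc m} (λ k → solve 3 (λ a b c → a :* (b :- c) := a :* b :- a :* c) refl
    (weight m (toℕ k)) (f (toℕ k)) (g (toℕ k))))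
  (∑-distrib-∸ (suc m) (λ k → weight m (toℕ k) * f (toℕ k)) (λ k → weight m (toℕ k) * g (toℕ k)))

egf-*ˡ : ∀ c f m → egf (λ k → c * f k) m ≡ c * egf f m
egf-*ˡ c f m = trans
  (sum-cong-≗ {suc m} (λ k → solve 3 (λ w c a → w :* (c :* a) := c :* (w :* a)) refl
    (weight m (toℕ k)) c (f (toℕ k))))
  (sym (*-distribˡ-sum {suc m} c (λ k → weight m (toℕ k) * f (toℕ k))))

-- Substituting for y commutes with multiplying by a series in x alone: two finite sums are
-- exchanged.
egf-⋆ : ∀ (F : Series₂) g m n →
  egf (λ l → ((λ k → F k l) ⋆ g) m) n ≡ ((λ k → egf (F k) n) ⋆ g) m
egf-⋆ F g m n = begin
  ∑[ l ≤ n ] (w l * ∑[ k ≤ m ] (F (toℕ k) (toℕ l) * g (m ∸ toℕ k)))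
    ≡⟨ sum-cong-≗ {suc n} (λ l → *-distribˡ-sum {suc m} (w l) (λ k → F (toℕ k) (toℕ l) * g (m ∸ toℕ k))) ⟩
  ∑[ l ≤ n ] ∑[ k ≤ m ] (w l * (F (toℕ k) (toℕ l) * g (m ∸ toℕ k)))
    ≡⟨ ∑-comm {suc n} {suc m} (λ l k → w l * (F (toℕ k) (toℕ l) * g (m ∸ toℕ k))) ⟩
  ∑[ k ≤ m ] ∑[ l ≤ n ] (w l * (F (toℕ k) (toℕ l) * g (m ∸ toℕ k)))
    ≡⟨ sum-cong-≗ {suc m} (λ k → trans
         (sum-cong-≗ {suc n} (λ l → sym (*-assoc (w l) (F (toℕ k) (toℕ l)) (g (m ∸ toℕ k)))))
         (sym (*-distribʳ-sum {suc n} (g (m ∸ toℕ k)) (λ l → w l * F (toℕ k) (toℕ l))))) ⟩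
  ∑[ k ≤ m ] (∑[ l ≤ n ] (w l * F (toℕ k) (toℕ l)) * g (m ∸ toℕ k)) ∎
  where
  w : Fin (suc n) → ℚ
  w l = weight n (toℕ l)

-- (1 + t) d/dt becomes d/du under t = eᵘ - 1.
egf-suc : ∀ f m → egf f (suc m) ≡ egf (θ f) m
egf-suc f m = begin
  0ℚ * f 0 + ∑[ k ≤ m ] (weight (suc m) (suc (toℕ k)) * f (suc (toℕ k)))
    ≡⟨ cong (_+_ (0ℚ * f 0)) (sum-cong-≗ {suc m} (λ k → split (toℕ k))) ⟩
  0ℚ * f 0 + ∑[ k ≤ m ] (a (toℕ k) + b (suc (toℕ k)))
    ≡⟨ cong (_+_ (0ℚ * f 0)) (∑-distrib-+ {suc m} (λ k → a (toℕ k)) (λ k → b (suc (toℕ k)))) ⟩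
  0ℚ * f 0 + (∑[ k ≤ m ] a (toℕ k) + ∑[ k ≤ m ] b (suc (toℕ k)))
    -- The product with `w` is `b 0`, a zero that lets the second sum start at k = 0. Its last term
    -- `b (suc m)` then vanishes by `weight-above`.
    ≡⟨ solve 4 (λ f₀ w A B → con 0ℚ :* f₀ :+ (A :+ B) := A :+ (w :* (con 0ℚ :* f₀) :+ B)) refl
         (f 0) (weight m 0) (∑[ k ≤ m ] a (toℕ k)) (∑[ k ≤ m ] b (suc (toℕ k))) ⟩
  ∑[ k ≤ m ] a (toℕ k) + ∑[ k ≤ suc m ] b (toℕ k)
    ≡⟨ cong (_+_ (∑[ k ≤ m ] a (toℕ k))) (trans (∑-≤-suc m b) (cong (_+_ (∑[ k ≤ m ] b (toℕ k)))
         (trans (cong (_* t∂ f (suc m)) (weight-above m)) (*-zeroˡ (t∂ f (suc m)))))) ⟩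
  ∑[ k ≤ m ] a (toℕ k) + (∑[ k ≤ m ] b (toℕ k) + 0ℚ)
    ≡⟨ cong (_+_ (∑[ k ≤ m ] a (toℕ k))) (+-identityʳ (∑[ k ≤ m ] b (toℕ k))) ⟩
  egf (λ k → t∂ f (suc k)) m + egf (t∂ f) m
    ≡⟨ egf-+ (λ k → t∂ f (suc k)) (t∂ f) m ⟨
  egf (θ f) m ∎
  where
  a b : Series₁
  a k = weight m k * t∂ f (suc k)
  b k = weight m k * t∂ f k
  split : ∀ k → weight (suc m) (suc k) * f (suc k) ≡ a k + b (suc k)
  split k = trans (cong (_* f (suc k)) (weight-suc m k))
    (solve 4 (λ w w′ c p → (w :* c :+ w′ :* c) :* p := w :* (c :* p) :+ w′ :* (c :* p)) refl
      (weight m k) (weight m (suc k)) (fromℕ (suc k)) (f (suc k)))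

-- log(1 + t) becomes u, and multiplication by u turns the coefficients aₘ of uᵐ/m! into m aₘ₋₁. The
-- proof differentiates once: by `θ-⋆-log1+` the derivative is a product of the same shape, with
-- `θ f` for f, plus f itself. At m = 0 the value of `pred` is immaterial, as its factor is 0.
egf-⋆-log1+ : ∀ f m → egf (f ⋆ log1+) m ≡ fromℕ m * egf f (pred m)
egf-⋆-log1+ f zero = solve 2 (λ a b → con 1ℚ :* (a :* con 0ℚ :+ con 0ℚ) :+ con 0ℚ := con 0ℚ :* b) refl
  (f 0) (egf f 0)
egf-⋆-log1+ f (suc m) = begin
  egf (f ⋆ log1+) (suc m)
    ≡⟨ egf-suc (f ⋆ log1+) m ⟩
  egf (θ (f ⋆ log1+)) m
    ≡⟨ egf-cong (θ-⋆-log1+ f) m ⟩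
  egf (λ k → (θ f ⋆ log1+) k + f k) m
    ≡⟨ egf-+ (θ f ⋆ log1+) f m ⟩
  egf (θ f ⋆ log1+) m + egf f m
    ≡⟨ cong (_+ egf f m) (trans (egf-⋆-log1+ (θ f) m) (lower m)) ⟩
  fromℕ m * egf f m + egf f m
    ≡⟨ solve 2 (λ a b → a :* b :+ b := (con 1ℚ :+ a) :* b) refl (fromℕ m) (egf f m) ⟩
  (1ℚ + fromℕ m) * egf f m
    ≡⟨ cong (_* egf f m) (fromℕ-homo-+ 1 m) ⟨
  fromℕ (suc m) * egf f m ∎
  where
  -- The derivative in `θ f` restores the index that `pred` lowered; at m = 0 both sides are 0.
  lower : ∀ m → fromℕ m * egf (θ f) (pred m) ≡ fromℕ m * egf f m
  lower zero    = trans (*-zeroˡ (egf (θ f) 0)) (sym (*-zeroˡ (egf f 0)))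
  lower (suc m) = cong (fromℕ (suc m) *_) (sym (egf-suc f m))

-- Images of t, 1, log(1 + t) and its square

egf-var-suc : ∀ m → egf var (suc m) ≡ 1ℚ
egf-var-suc m = begin
  0ℚ * 0ℚ + (weight (suc m) 1 * 1ℚ + ∑[ k < m ] (weight (suc m) (suc (suc (toℕ k))) * 0ℚ))
    ≡⟨ cong₂ (λ p q → 0ℚ * 0ℚ + (p * 1ℚ + q)) (weight-1 m)
         (∑-zero m (λ k → *-zeroʳ (weight (suc m) (suc (suc (toℕ k)))))) ⟩
  1ℚ ∎

one : Series₁
one zero    = 1ℚ
one (suc _) = 0ℚ

log² : Series₁
log² = log1+ ⋆ log1+

egf-log1+ : ∀ m → egf log1+ m ≡ fromℕ m * egf one (pred m)
egf-log1+ m = trans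
  (egf-cong (λ k → sym (trans (⋆-constantˡ {one} {log1+} (λ _ → refl) k) (*-identityˡ (log1+ k)))) m)
  (egf-⋆-log1+ one m)

egf-one-suc : ∀ m → egf one (suc m) ≡ 0ℚ
egf-one-suc m = cong (_+_ (0ℚ * 1ℚ)) (∑-zero (suc m) (λ k → *-zeroʳ (weight (suc m) (suc (toℕ k)))))

-- The image is u², obtained from 1 by multiplying by u twice; hence the value is 2 at m = 2 and 0
-- elsewhere.
egf-log² : ∀ m → egf log² m ≡ fromℕ m * (fromℕ (pred m) * egf one (pred (pred m)))
egf-log² m = trans (egf-⋆-log1+ log1+ m) (cong (fromℕ m *_) (egf-log1+ (pred m)))

egf-log²-3+ : ∀ m → egf log² (3 ℕ.+ m) ≡ 0ℚ
egf-log²-3+ m = begin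
  egf log² (3 ℕ.+ m)                                          ≡⟨ egf-log² (3 ℕ.+ m) ⟩
  fromℕ (3 ℕ.+ m) * (fromℕ (2 ℕ.+ m) * egf one (suc m))       ≡⟨ cong (λ p → fromℕ (3 ℕ.+ m) * (fromℕ (2 ℕ.+ m) * p)) (egf-one-suc m) ⟩
  fromℕ (3 ℕ.+ m) * (fromℕ (2 ℕ.+ m) * 0ℚ)                    ≡⟨ solve 2 (λ a b → a :* (b :* con 0ℚ) := con 0ℚ) refl (fromℕ (3 ℕ.+ m)) (fromℕ (2 ℕ.+ m)) ⟩
  0ℚ                                                          ∎

-- The generating function of the Gregory coefficients at (eᵘ - 1, eᵛ - 1)

-- `egf₂ F m n` is m! n! times the coefficient of uᵐvⁿ in F(eᵘ - 1, eᵛ - 1).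
egf₂ : Series₂ → Series₂
egf₂ F m n = egf (λ k → egf (F k) n) m

egf₂-cong : ∀ {F H} → F ≈ H → egf₂ F ≈ egf₂ H
egf₂-cong F≈H m n = egf-cong (λ k → egf-cong (F≈H k) n) m

egf₂-⊖ : ∀ F H → egf₂ (F ⊖ H) ≈ egf₂ F ⊖ egf₂ H
egf₂-⊖ F H m n = trans (egf-cong (λ k → egf-∸ (F k) (H k) n) m)
  (egf-∸ (λ k → egf (F k) n) (λ k → egf (H k) n) m)

egf₂-log[1+x] : ∀ G m n → egf₂ (G ⊛ log[1+x]) m n ≡ fromℕ m * egf₂ G (pred m) n
egf₂-log[1+x] G m n = begin
  egf₂ (G ⊛ log[1+x]) m n
    ≡⟨ egf₂-cong (⊛-inX {log1+} G (λ _ _ → refl)) m n ⟩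
  egf (λ k → egf (λ l → ((λ i → G i l) ⋆ log1+) k) n) m
    ≡⟨ egf-cong (λ k → egf-⋆ G log1+ k n) m ⟩
  egf ((λ i → egf (G i) n) ⋆ log1+) m
    ≡⟨ egf-⋆-log1+ (λ i → egf (G i) n) m ⟩
  fromℕ m * egf₂ G (pred m) n ∎

egf₂-log[1+y] : ∀ G m n → egf₂ (G ⊛ log[1+y]) m n ≡ fromℕ n * egf₂ G m (pred n)
egf₂-log[1+y] G m n = begin
  egf₂ (G ⊛ log[1+y]) m n
    ≡⟨ egf₂-cong (⊛-inY {log1+} G (λ _ _ → refl)) m n ⟩
  egf (λ k → egf (G k ⋆ log1+) n) m
    ≡⟨ egf-cong (λ k → egf-⋆-log1+ (G k) n) m ⟩
  egf (λ k → fromℕ n * egf (G k) (pred n)) m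
    ≡⟨ egf-*ˡ (fromℕ n) (λ k → egf (G k) (pred n)) m ⟩
  fromℕ n * egf₂ G m (pred n) ∎

egf₂-product : ∀ f g m n → egf₂ (λ k l → f k * g l) m n ≡ egf f m * egf g n
egf₂-product f g m n = begin
  egf (λ k → egf (λ l → f k * g l) n) m   ≡⟨ egf-cong (λ k → trans (egf-*ˡ (f k) g n) (*-comm (f k) (egf g n))) m ⟩
  egf (λ k → egf g n * f k) m             ≡⟨ egf-*ˡ (egf g n) f m ⟩
  egf g n * egf f m                       ≡⟨ *-comm (egf g n) (egf f m) ⟩
  egf f m * egf g n                       ∎

log[1+x]² : log[1+x] ⊛ log[1+x] ≈ inX log²
log[1+x]² m zero    = ⊛-inX {log1+} log[1+x] (λ _ _ → refl) m 0
log[1+x]² m (suc n) = trans (⊛-inX {log1+} log[1+x] (λ _ _ → refl) m (suc n))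
  (∑-zero (suc m) (λ i → *-zeroˡ (log1+ (m ∸ toℕ i))))

log[1+y]² : log[1+y] ⊛ log[1+y] ≈ inY log²
log[1+y]² zero    n = ⊛-inY {log1+} log[1+y] (λ _ _ → refl) 0 n
log[1+y]² (suc m) n = trans (⊛-inY {log1+} log[1+y] (λ _ _ → refl) (suc m) n)
  (∑-zero (suc n) (λ i → *-zeroˡ (log1+ (n ∸ toℕ i))))

y⊛log[1+x]² : ∀ m n → (y ⊛ (log[1+x] ⊛ log[1+x])) m n ≡ log² m * var n
y⊛log[1+x]² m n = trans (⊛-inX {log²} y log[1+x]² m n)
  -- `y` does not involve x: for fixed n, `inX var n` is the constant series with value `var n`.
  (trans (⋆-constantˡ {inX var n} {log²} (λ _ → refl) m) (*-comm (var n) (log² m)))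

x⊛log[1+y]² : ∀ m n → (x ⊛ (log[1+y] ⊛ log[1+y])) m n ≡ var m * log² n
x⊛log[1+y]² m n = trans (⊛-inY {log²} x log[1+y]² m n) (⋆-constantˡ {inX var m} {log²} (λ _ → refl) n)

-- (u - v) P = (eᵛ - 1) u² - (eᵘ - 1) v² by coefficients.
GregoryEquation : Series₂ → Set
GregoryEquation P = ∀ m n → fromℕ m * P (pred m) n - fromℕ n * P m (pred n)
  ≡ egf log² m * egf var n - egf var m * egf log² n

-- The substitution is applied to both sides of the defining equation: the denominator becomes u -
-- v, and each product in the numerator separates into one-variable images.
egf₂-gregory : ∀ {G} → IsGeneralizedGregory G → GregoryEquation (egf₂ G)
egf₂-gregory {G} isG m n = begin
  fromℕ m * egf₂ G (pred m) n - fromℕ n * egf₂ G m (pred n)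
    ≡⟨ cong₂ _-_ (egf₂-log[1+x] G m n) (egf₂-log[1+y] G m n) ⟨
  egf₂ (G ⊛ log[1+x]) m n - egf₂ (G ⊛ log[1+y]) m n
    ≡⟨ egf₂-⊖ (G ⊛ log[1+x]) (G ⊛ log[1+y]) m n ⟨
  egf₂ (G ⊛ log[1+x] ⊖ G ⊛ log[1+y]) m n
    ≡⟨ egf₂-cong (⊛-distribˡ-⊖ G log[1+x] log[1+y]) m n ⟨
  egf₂ (G ⊛ gregoryDenominator) m n
    ≡⟨ egf₂-cong isG m n ⟩
  egf₂ gregoryNumerator m n
    ≡⟨ egf₂-⊖ (y ⊛ (log[1+x] ⊛ log[1+x])) (x ⊛ (log[1+y] ⊛ log[1+y])) m n ⟩
  egf₂ (y ⊛ (log[1+x] ⊛ log[1+x])) m n - egf₂ (x ⊛ (log[1+y] ⊛ log[1+y])) m n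
    ≡⟨ cong₂ _-_ (trans (egf₂-cong y⊛log[1+x]² m n) (egf₂-product log² var m n))
                 (trans (egf₂-cong x⊛log[1+y]² m n) (egf₂-product var log² m n)) ⟩
  egf log² m * egf var n - egf var m * egf log² n ∎

-- Solution of the equation row by row

gregory-step : ∀ {P} → GregoryEquation P → ∀ m n → fromℕ n * P m (pred n)
  ≡ fromℕ m * P (pred m) n - (egf log² m * egf var n - egf var m * egf log² n)
gregory-step {P} eq m n = trans
  (solve 2 (λ a b → b := a :- (a :- b)) refl (fromℕ m * P (pred m) n) (fromℕ n * P m (pred n)))
  (cong (_-_ (fromℕ m * P (pred m) n)) (eq m n))

-- Exchanging u and v changes the sign of both sides, so facts about rows yield facts about columns.
GregoryEquation-flip : ∀ {P} → GregoryEquation P → GregoryEquation (λ m n → P n m)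
GregoryEquation-flip {P} eq m n = begin
  fromℕ m * P n (pred m) - fromℕ n * P (pred n) m
    ≡⟨ swap (fromℕ n * P (pred n) m) (fromℕ m * P n (pred m)) ⟩
  - (fromℕ n * P (pred n) m - fromℕ m * P n (pred m))
    ≡⟨ cong -_ (eq n m) ⟩
  - (egf log² n * egf var m - egf var n * egf log² m)
    ≡⟨ solve 4 (λ a b c d → :- (a :* b :- c :* d) := d :* c :- b :* a) refl
         (egf log² n) (egf var m) (egf var n) (egf log² m) ⟩
  egf log² m * egf var n - egf var m * egf log² n ∎
  where
  swap : ∀ p q → q - p ≡ - (p - q)
  swap = solve 2 (λ p q → q :- p := :- (p :- q)) refl

-- In row 0 the right-hand side is 0, because eᵘ - 1 and u² both vanish at u = 0; the entry at
-- `pred 0` enters with factor 0.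
gregory-row₀ : ∀ {P} → GregoryEquation P → ∀ n → P 0 n ≡ 0ℚ
gregory-row₀ {P} eq n = fromℕ-*-cancelˡ (suc n) (begin
  fromℕ (suc n) * P 0 n
    ≡⟨ gregory-step {P} eq 0 (suc n) ⟩
  0ℚ * P 0 (suc n) - (0ℚ * egf var (suc n) - 0ℚ * egf log² (suc n))
    ≡⟨ solve 4 (λ a b c d → con 0ℚ :* a :- (con 0ℚ :* b :- con 0ℚ :* c) := d :* con 0ℚ) refl
         (P 0 (suc n)) (egf var (suc n)) (egf log² (suc n)) (fromℕ (suc n)) ⟩
  fromℕ (suc n) * 0ℚ ∎)

-- As row 0 is zero and u² has no term of degree 1, only (eᵘ - 1)v² contributes, so row 1 is v²
-- divided by v.
gregory-row₁ : ∀ {P} → GregoryEquation P → ∀ n → fromℕ (suc n) * P 1 n ≡ egf log² (suc n)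
gregory-row₁ {P} eq n = begin
  fromℕ (suc n) * P 1 n
    ≡⟨ gregory-step {P} eq 1 (suc n) ⟩
  1ℚ * P 0 (suc n) - (0ℚ * egf var (suc n) - 1ℚ * egf log² (suc n))
    ≡⟨ cong (λ p → 1ℚ * p - (0ℚ * egf var (suc n) - 1ℚ * egf log² (suc n))) (gregory-row₀ {P} eq (suc n)) ⟩
  1ℚ * 0ℚ - (0ℚ * egf var (suc n) - 1ℚ * egf log² (suc n))
    ≡⟨ solve 2 (λ a b → con 1ℚ :* con 0ℚ :- (con 0ℚ :* a :- con 1ℚ :* b) := b) refl
         (egf var (suc n)) (egf log² (suc n)) ⟩
  egf log² (suc n) ∎

gregory-1-1 : ∀ {P} → GregoryEquation P → P 1 1 ≡ 1ℚ
-- `egf log² 2` evaluates to 2.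
gregory-1-1 {P} eq = fromℕ-*-cancelˡ 2 (gregory-row₁ {P} eq 1)

gregory-1-2+ : ∀ {P} → GregoryEquation P → ∀ n → P 1 (2 ℕ.+ n) ≡ 0ℚ
gregory-1-2+ {P} eq n = fromℕ-*-cancelˡ (3 ℕ.+ n) (trans (gregory-row₁ {P} eq (2 ℕ.+ n))
  (trans (egf-log²-3+ n) (sym (*-zeroʳ (fromℕ (3 ℕ.+ n))))))

-- Denominators are cleared by the factorial. The induction on m leaves n free: each step trades a
-- row for a column, staying on one antidiagonal until row 2 is reached.
gregory-2+-2+ : ∀ {P} → GregoryEquation P → ∀ m n →
  fromℕ ((suc m ℕ.+ (2 ℕ.+ n)) !) * P (2 ℕ.+ m) (2 ℕ.+ n) ≡ - fromℕ ((2 ℕ.+ m) ! ℕ.* (2 ℕ.+ n) !)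
gregory-2+-2+ {P} eq zero n = begin
  fromℕ ((3 ℕ.+ n) !) * p
    ≡⟨ cong (_* p) (fromℕ-homo-* (3 ℕ.+ n) N) ⟩
  c * fromℕ N * p
    ≡⟨ solve 3 (λ c N p → c :* N :* p := N :* (c :* p)) refl c (fromℕ N) p ⟩
  fromℕ N * (c * p)
    -- Row 2 is where (eᵛ - 1)u² enters, with value 2 · 1; the entry of row 1 in this column is 0.
    ≡⟨ cong (fromℕ N *_) (gregory-step {P} eq 2 (3 ℕ.+ n)) ⟩
  fromℕ N * (fromℕ 2 * P 1 (3 ℕ.+ n) - (fromℕ 2 * egf var (3 ℕ.+ n) - 1ℚ * egf log² (3 ℕ.+ n)))
    ≡⟨ cong (λ q → fromℕ N * (fromℕ 2 * q - (fromℕ 2 * egf var (3 ℕ.+ n) - 1ℚ * egf log² (3 ℕ.+ n))))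
         (gregory-1-2+ {P} eq (suc n)) ⟩
  fromℕ N * (fromℕ 2 * 0ℚ - (fromℕ 2 * egf var (3 ℕ.+ n) - 1ℚ * egf log² (3 ℕ.+ n)))
    ≡⟨ cong₂ (λ v l → fromℕ N * (fromℕ 2 * 0ℚ - (fromℕ 2 * v - 1ℚ * l)))
         (egf-var-suc (2 ℕ.+ n)) (egf-log²-3+ n) ⟩
  fromℕ N * (fromℕ 2 * 0ℚ - (fromℕ 2 * 1ℚ - 1ℚ * 0ℚ))
    ≡⟨ solve 1 (λ N → N :* con (- fromℕ 2) := :- (con (fromℕ 2) :* N)) refl (fromℕ N) ⟩
  - (fromℕ 2 * fromℕ N)
    ≡⟨ cong -_ (fromℕ-homo-* 2 N) ⟨
  - fromℕ (2 ! ℕ.* N) ∎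
  where
  N = (2 ℕ.+ n) !
  c = fromℕ (3 ℕ.+ n)
  p = P 2 (2 ℕ.+ n)
gregory-2+-2+ {P} eq (suc m) n = fromℕ-*-cancelˡ (3 ℕ.+ n) (begin
  c * (F * p)
    ≡⟨ solve 3 (λ c F p → c :* (F :* p) := F :* (c :* p)) refl c F p ⟩
  F * (c * p)
    ≡⟨ cong (F *_) (gregory-step {P} eq (3 ℕ.+ m) (3 ℕ.+ n)) ⟩
  F * (d * q - (egf log² (3 ℕ.+ m) * egf var (3 ℕ.+ n) - egf var (3 ℕ.+ m) * egf log² (3 ℕ.+ n)))
    -- From row 3 and column 3 on, u² and v² contribute nothing, so the equation reduces to `c * p`
    -- = `d * q`.
    ≡⟨ cong₂ (λ k l → F * (d * q - (k * egf var (3 ℕ.+ n) - egf var (3 ℕ.+ m) * l)))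
         (egf-log²-3+ m) (egf-log²-3+ n) ⟩
  F * (d * q - (0ℚ * egf var (3 ℕ.+ n) - egf var (3 ℕ.+ m) * 0ℚ))
    ≡⟨ solve 5 (λ F d q a b → F :* (d :* q :- (con 0ℚ :* a :- b :* con 0ℚ)) := d :* (F :* q)) refl
         F d q (egf var (3 ℕ.+ n)) (egf var (3 ℕ.+ m)) ⟩
  d * (F * q)
    -- `p` and `q` lie on the same antidiagonal, so the same factorial serves the induction
    -- hypothesis.
    ≡⟨ cong (λ e → d * (fromℕ (suc e !) * q)) (sym (ℕ.+-suc m (2 ℕ.+ n))) ⟩
  d * (fromℕ ((suc m ℕ.+ (3 ℕ.+ n)) !) * q)
    ≡⟨ cong (d *_) (gregory-2+-2+ {P} eq m (suc n)) ⟩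
  d * - fromℕ (M ℕ.* (3 ℕ.+ n) !)
    ≡⟨ cong (λ e → d * - e) (trans (fromℕ-homo-* M ((3 ℕ.+ n) !))
         (cong (fromℕ M *_) (fromℕ-homo-* (3 ℕ.+ n) N))) ⟩
  d * - (fromℕ M * (c * fromℕ N))
    ≡⟨ solve 4 (λ d M c N → d :* (:- (M :* (c :* N))) := c :* (:- (d :* M :* N))) refl
         d (fromℕ M) c (fromℕ N) ⟩
  c * - (d * fromℕ M * fromℕ N)
    ≡⟨ cong (λ e → c * - e) (trans (fromℕ-homo-* ((3 ℕ.+ m) !) N)
         (cong (_* fromℕ N) (fromℕ-homo-* (3 ℕ.+ m) M))) ⟨
  c * - fromℕ ((3 ℕ.+ m) ! ℕ.* N) ∎)
  where
  M = (2 ℕ.+ m) !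
  N = (2 ℕ.+ n) !
  c = fromℕ (3 ℕ.+ n)
  d = fromℕ (3 ℕ.+ m)
  F = fromℕ ((suc (suc m) ℕ.+ (2 ℕ.+ n)) !)
  p = P (3 ℕ.+ m) (2 ℕ.+ n)
  q = P (2 ℕ.+ m) (3 ℕ.+ n)

gregory-fraction : ∀ {P} → GregoryEquation P → ∀ m n →
  P (2 ℕ.+ m) (2 ℕ.+ n) ≡ - (((2 ℕ.+ m) ! ℕ.* (2 ℕ.+ n) !) /! (suc m ℕ.+ (2 ℕ.+ n)))
gregory-fraction {P} eq m n = fromℕ-*-cancelˡ (k !) (begin
  fromℕ (k !) * P (2 ℕ.+ m) (2 ℕ.+ n)   ≡⟨ gregory-2+-2+ {P} eq m n ⟩
  - fromℕ a                             ≡⟨ cong -_ (fromℕ-*-/ (+ a) (k !)) ⟨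
  - (fromℕ (k !) * (a /! k))            ≡⟨ neg-distribʳ-* (fromℕ (k !)) (a /! k) ⟩
  fromℕ (k !) * - (a /! k)              ∎)
  where
  a = (2 ℕ.+ m) ! ℕ.* (2 ℕ.+ n) !
  k = suc m ℕ.+ (2 ℕ.+ n)
  instance _ = k ℕ.!≢0

-- Sums from 2

egf-1 : ∀ f → egf f 1 ≡ f 1
egf-1 f = solve 2 (λ a b → con 0ℚ :* a :+ (con 1ℚ :* b :+ con 0ℚ) := b) refl (f 0) (f 1)

-- In row 2 + m the omitted weights are 0 at k = 0 and 1 at k = 1, so the omission costs exactly
-- `f 1`.
sum-from-2 : ∀ f m → Σ[ k from 2 to 2 ℕ.+ m ] (weight (2 ℕ.+ m) k * f k) ≡ egf f (2 ℕ.+ m) - f 1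
sum-from-2 f m = begin
  tail
    ≡⟨ solve 3 (λ a b t → t := con 0ℚ :* a :+ (con 1ℚ :* b :+ t) :- b) refl (f 0) (f 1) tail ⟩
  0ℚ * f 0 + (1ℚ * f 1 + tail) - f 1
    ≡⟨ cong (λ w → 0ℚ * f 0 + (w * f 1 + tail) - f 1) (weight-1 (suc m)) ⟨
  egf f (2 ℕ.+ m) - f 1 ∎
  where
  tail : ℚ
  tail = Σ[ k from 2 to 2 ℕ.+ m ] (weight (2 ℕ.+ m) k * f k)

-- Inclusion-exclusion over k = 1 and l = 1. By `egf-1` the corrections are themselves entries of
-- `egf₂ G`, to which the equation applies.
sum-from-2² : ∀ G m n →
  Σ[ k from 2 to 2 ℕ.+ m ] Σ[ l from 2 to 2 ℕ.+ n ] (weight (2 ℕ.+ m) k * weight (2 ℕ.+ n) l * G k l)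
  ≡ egf₂ G (2 ℕ.+ m) (2 ℕ.+ n) - egf₂ G (2 ℕ.+ m) 1 - (egf₂ G 1 (2 ℕ.+ n) - egf₂ G 1 1)
sum-from-2² G m n = begin
  Σ[ k from 2 to 2 ℕ.+ m ] Σ[ l from 2 to 2 ℕ.+ n ] (w k * weight (2 ℕ.+ n) l * G k l)
    ≡⟨ sum-cong-≗ {suc m} (λ i → inner (2 ℕ.+ toℕ i)) ⟩
  Σ[ k from 2 to 2 ℕ.+ m ] (w k * r k)
    ≡⟨ sum-from-2 r m ⟩
  egf r (2 ℕ.+ m) - r 1
    ≡⟨ cong₂ _-_ (egf-∸ (λ k → egf (G k) (2 ℕ.+ n)) (λ k → egf (G k) 1) (2 ℕ.+ m))
         (sym (cong₂ _-_ (egf-1 (λ k → egf (G k) (2 ℕ.+ n))) (egf-1 (λ k → egf (G k) 1)))) ⟩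
  egf₂ G (2 ℕ.+ m) (2 ℕ.+ n) - egf₂ G (2 ℕ.+ m) 1 - (egf₂ G 1 (2 ℕ.+ n) - egf₂ G 1 1) ∎
  where
  w r : Series₁
  w = weight (2 ℕ.+ m)
  r k = egf (G k) (2 ℕ.+ n) - egf (G k) 1
  inner : ∀ k → Σ[ l from 2 to 2 ℕ.+ n ] (w k * weight (2 ℕ.+ n) l * G k l) ≡ w k * r k
  inner k = begin
    Σ[ l from 2 to 2 ℕ.+ n ] (w k * weight (2 ℕ.+ n) l * G k l)
      ≡⟨ sum-cong-≗ {suc n} (λ j → *-assoc (w k) (weight (2 ℕ.+ n) (2 ℕ.+ toℕ j)) (G k (2 ℕ.+ toℕ j))) ⟩
    Σ[ l from 2 to 2 ℕ.+ n ] (w k * (weight (2 ℕ.+ n) l * G k l))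
      ≡⟨ *-distribˡ-sum {suc n} (w k) (λ j → weight (2 ℕ.+ n) (2 ℕ.+ toℕ j) * G k (2 ℕ.+ toℕ j)) ⟨
    w k * Σ[ l from 2 to 2 ℕ.+ n ] (weight (2 ℕ.+ n) l * G k l)
      ≡⟨ cong (w k *_) (trans (sum-from-2 (G k) n) (cong (_-_ (egf (G k) (2 ℕ.+ n))) (sym (egf-1 (G k))))) ⟩
    w k * r k ∎

theorem5p5 : (G : Series₂) → IsGeneralizedGregory G →
    (m n : ℕ) → 2 ≤ m → 2 ≤ n →
    Σ[ k from 2 to m ] Σ[ l from 2 to n ]
    (fromℕ (k ! ℕ.* stirling₂ m k) * fromℕ (l ! ℕ.* stirling₂ n l) * G k l)
    ≡ 1ℚ - (m ! ℕ.* n !) /! (m ℕ.+ n ∸ 1)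
theorem5p5 G isG (suc (suc m)) (suc (suc n)) (s≤s (s≤s z≤n)) (s≤s (s≤s z≤n)) = begin
  Σ[ k from 2 to 2 ℕ.+ m ] Σ[ l from 2 to 2 ℕ.+ n ] (weight (2 ℕ.+ m) k * weight (2 ℕ.+ n) l * G k l)
    ≡⟨ sum-from-2² G m n ⟩
  egf₂ G (2 ℕ.+ m) (2 ℕ.+ n) - egf₂ G (2 ℕ.+ m) 1 - (egf₂ G 1 (2 ℕ.+ n) - egf₂ G 1 1)
    -- Of the corrections only the entry (1, 1) is nonzero, and it yields the summand 1; column 1 is
    -- read as row 1 after the flip.
    ≡⟨ cong₂ _-_
         (cong₂ _-_ (gregory-fraction {egf₂ G} eq m n)
                    (gregory-1-2+ {λ k l → egf₂ G l k} (GregoryEquation-flip {egf₂ G} eq) m))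
         (cong₂ _-_ (gregory-1-2+ {egf₂ G} eq n) (gregory-1-1 {egf₂ G} eq)) ⟩
  - r - 0ℚ - (0ℚ - 1ℚ)
    ≡⟨ solve 1 (λ r → :- r :- con 0ℚ :- (con 0ℚ :- con 1ℚ) := con 1ℚ :- r) refl r ⟩
  1ℚ - r ∎
  where
  eq = egf₂-gregory {G} isG
  r = ((2 ℕ.+ m) ! ℕ.* (2 ℕ.+ n) !) /! (suc m ℕ.+ (2 ℕ.+ n))
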